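{- Let $N$ and $N'$ denote labeled fluid stochastic Petri nets (LFSPNs), each having exactly one continuous place, with fluid bisimulation equivalence written $N\leftrightarrow_{fl}N'$ and fluid trace equivalence written $N\equiv_{fl}N'$. Then the following strict implication holds: for all such LFSPNs $N$ and $N'$, $$N\leftrightarrow_{fl}N'\ \Rightarrow\ N\equiv_{fl}N',$$ and the reverse implication does not hold in general, i.e. there exist such LFSPNs $N$ and $N'$ with $N\equiv_{fl}N'$ but not $N\leftrightarrow_{fl}N'$.
   Context: Notation: $\mathbb N=\{0,1,2,\ldots\}$; $Act$ is a set of actions; $X^*$ is the set of all finite sequences over a set $X$ (including the empty sequence $\varepsilon$); for sequences of numbers, $\circ$ denotes concatenation. An LFSPN is a tuple $N=(P_N,T_N,W_N,C_N,R_N,\Omega_N,L_N,\mathcal M_N)$, where: $P_N=Pd_N\uplus Pc_N$ is a finite set of discrete places ($Pd_N$) and continuous places ($Pc_N$); $T_N$ is a finite set of transitions, $P_N\cup T_N\neq\emptyset$, $P_N\cap T_N=\emptyset$; $W_N:(Pd_N\times T_N)\cup(T_N\times Pd_N)\to\mathbb N$ gives weights of discrete arcs; $C_N\subseteq(Pc_N\times T_N)\cup(T_N\times Pc_N)$ is the set of continuous arcs; $R_N:C_N\times\mathbb N^{|Pd_N|}\to\mathbb R_{\ge0}$ gives flow rates of continuous arcs in a discrete marking; $\Omega_N:T_N\times\mathbb N^{|Pd_N|}\to\mathbb R_{>0}$ gives transition rates in a discrete marking; $L_N:T_N\to Act$ is the labeling; $\mathcal M_N=(M_N,\mathbf 0)$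 is the initial marking, with $M_N\in\mathbb N^{|Pd_N|}$ the initial discrete marking and $\mathbf 0$ meaning all continuous places are empty. A discrete marking is $M:Pd_N\to\mathbb N$. $Ena(M)=\{t\in T_N\mid \forall p\in Pd_N\ W_N(p,t)\le M(p)\}$. For $t\in Ena(M)$ we write $M\stackrel{t}{\rightarrow}\widetilde M$, where $\widetilde M(p)=M(p)-W_N(p,t)+W_N(t,p)$ for all $p\in Pd_N$. $DRS(N)$ is the smallest set of discrete markings containing $M_N$ and closed under $\stackrel{t}{\rightarrow}$ for all $t$. Let $Pc_N=\{q\}$. For $M\in DRS(N)$: $SJ(M)=1/\sum_{t\in Ena(M)}\Omega_N(t,M)$ is the average sojourn time (with $SJ(M)=\infty$ if $Ena(M)=\emptyset$); $PT(t,M)=\Omega_N(t,M)/\sum_{u\in Ena(M)}\Omega_N(u,M)$ for $t\in Ena(M)$; and the potential fluid flow rate is $$RP(M)=\sum_{\{t\in Ena(M)\mid (t,q)\in C_N\}}R_N((t,q),M)-\sum_{\{t\in Ena(M)\mid (q,t)\in C_N\}}R_N((q,t),M).$$ Fluid trace equivalence. $TranSeq(N)$ is the set of all transition sequences $\vartheta=t_1\cdots t_n$ ($n\ge0$; $\vartheta=\varepsilon$ for $n=0$) with $M_N=M_0\stackrel{t_1}{\rightarrow}M_1\cdots\stackrel{t_n}{\rightarrow}M_n$. For such $\vartheta$: $PT(\vartheta)=\prod_{i=1}^nPT(t_i,M_{i-1})$ (so $PT(\varepsilon)=1$), $L_N(\vartheta)=L_N(t_1)\cdots L_N(t_n)$,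 $SJ(\vartheta)=SJ(M_0)\circ\cdots\circ SJ(M_n)$, $RP(\vartheta)=RP(M_0)\circ\cdots\circ RP(M_n)$. For $(\sigma,\varsigma,\varrho)\in Act^*\times\mathbb R_{>0}^*\times\mathbb R^*$, $TranSeq(N,\sigma,\varsigma,\varrho)=\{\vartheta\in TranSeq(N)\mid L_N(\vartheta)=\sigma,\ SJ(\vartheta)=\varsigma,\ RP(\vartheta)=\varrho\}$. Then $N\equiv_{fl}N'$ iff for all $(\sigma,\varsigma,\varrho)\in Act^*\times\mathbb R_{>0}^*\times\mathbb R^*$: $\sum_{\vartheta\in TranSeq(N,\sigma,\varsigma,\varrho)}PT(\vartheta)=\sum_{\vartheta'\in TranSeq(N',\sigma,\varsigma,\varrho)}PT(\vartheta')$. Fluid bisimulation equivalence. For $a\in Act$, a marking $M$ of $N$ and a set $\mathcal H$ of discrete markings, $RM_a(M,\mathcal H)=\sum_{\{t\mid\exists\widetilde M\in\mathcal H\ M\stackrel{t}{\rightarrow}\widetilde M,\ L_N(t)=a\}}\Omega_N(t,M)$ (similarly for $N'$). Let $Pc_N=\{q\}$, $Pc_{N'}=\{q'\}$; $q'$ corresponds to $q$, and $RP(M)$ is taken for $q$ if $M\in DRS(N)$ and for $q'$ if $M\in DRS(N')$. The sets $DRS(N)$ and $DRS(N')$ are treated as disjoint. An equivalence relation $\mathcal R\subseteq(DRS(N)\cup DRS(N'))^2$ is a fluid bisimulation between $N$ and $N'$ if (1) $(M_N,M_{N'})\in\mathcal R$; (2) $(M_1,M_2)\in\mathcal R$ implies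 $RP(M_1)=RP(M_2)$ and, for all equivalence classes $\mathcal H\in(DRS(N)\cup DRS(N'))/_{\mathcal R}$ and all $a\in Act$, $RM_a(M_1,\mathcal H)=RM_a(M_2,\mathcal H)$. $N\leftrightarrow_{fl}N'$ iff a fluid bisimulation between $N$ and $N'$ exists. -}

module Defs where

open import Algebra.Bundles using (CommutativeRing)
open import Axiom.ExcludedMiddle using (ExcludedMiddle)
open import Data.Bool.Base using (Bool; T)
open import Data.Fin.Base using (Fin)
open import Data.Irrelevant as irr using ()
open import Data.List.Base using (List; []; _∷_; length; map)
open import Data.List.Relation.Binary.Pointwise using (Pointwise)
open import Data.Nat.Base as ℕ using (ℕ; zero; suc)
open import Data.Product.Base using (Σ-syntax; ∃; _×_; _,_; proj₁)
open import Data.Refinement using (Refinement; Refinement-syntax; value)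
open import Data.Sum.Base using (_⊎_; inj₁; inj₂)
open import Data.Unit.Base using (⊤)
open import Data.Vec.Base using (Vec; lookup; tabulate)
open import Function.Base using (_∘_)
open import Level using (0ℓ)
open import Relation.Binary.Core using (Rel)
open import Relation.Binary.PropositionalEquality.Core using (_≡_)
open import Relation.Binary.Structures using (IsEquivalence; IsTotalOrder)
open import Relation.Nullary.Decidable.Core using (Dec; yes; no)
open import Relation.Nullary.Construct.Add.Supremum using (_⁺; ⊤⁺; [_])
open import Relation.Nullary.Negation.Core using (¬_)
open import Relation.Unary using (Pred)

import Algebra.Properties.CommutativeMonoid.Sum as Sum
import Relation.Binary.Construct.Add.Supremum.Equality as AddSup
import Relation.Binary.Construct.NonStrictToStrict as ToStrict

-- The real numbers, characterised classically (up to isomorphism) as a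
-- Dedekind-complete ordered field. The inverse is total; its value at 0#
-- is unspecified.
record CompleteOrderedField : Set₁ where
  infix  4 _≤_
  infix  8 _⁻¹
  field
    commutativeRing : CommutativeRing 0ℓ 0ℓ
  open CommutativeRing commutativeRing public
  field
    _⁻¹          : Carrier → Carrier
    ⁻¹-cong      : ∀ {x y} → x ≈ y → x ⁻¹ ≈ y ⁻¹
    *-inverseʳ   : ∀ x → ¬ (x ≈ 0#) → x * x ⁻¹ ≈ 1#
    1≉0          : ¬ (1# ≈ 0#)
    _≤_          : Rel Carrier 0ℓ
    isTotalOrder : IsTotalOrder _≈_ _≤_
    +-monoˡ-≤    : ∀ z {x y} → x ≤ y → x + z ≤ y + z
    *-nonNeg     : ∀ {x y} → 0# ≤ x → 0# ≤ y → 0# ≤ x * y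

  open ToStrict _≈_ _≤_ public using (_<_)

  UpperBound : Pred Carrier 0ℓ → Pred Carrier 0ℓ
  UpperBound S u = ∀ x → S x → x ≤ u

  field
    supremum     : (S : Pred Carrier 0ℓ) → ∃ S → ∃ (UpperBound S) →
                   ∃ λ s → UpperBound S s × (∀ u → UpperBound S u → s ≤ u)

  ℝ≥0 ℝ>0 : Set
  ℝ≥0 = Σ[ x ∈ Carrier ] 0# ≤ x
  ℝ>0 = Σ[ x ∈ Carrier ] 0# < x

-- Excluded middle decides membership in the index sets of the finite sums
-- below; equivalence classes of markings, in particular, need not be
-- decidable constructively.
module LFSPNs (em : ExcludedMiddle 0ℓ) (ℝ : CompleteOrderedField) (Act : Set) where

  open CompleteOrderedField ℝ
  open Sum +-commutativeMonoid using (sum)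
  open AddSup _≈_ using (_≈⁺_)

  -- ite P f is f p if P holds with proof p, and 0 otherwise.
  ite : (P : Set) → (P → Carrier) → Carrier
  ite P f = go em
    where
    go : Dec P → Carrier
    go (yes p) = f p
    go (no  _) = 0#

  -- ∑ P f is the sum of f over the subset {i | P i} of Fin n; f need only be
  -- defined on that subset.
  ∑ : ∀ {n} (P : Pred (Fin n) 0ℓ) → (∀ i → P i → Carrier) → Carrier
  ∑ P f = sum λ i → ite (P i) (f i)

  -- ∑words k P f is the sum of f over the words of length k satisfying P.
  ∑words : ∀ {n} → ℕ → Pred (List (Fin n)) 0ℓ → (List (Fin n) → Carrier) → Carrier
  ∑words zero    P f = ite (P []) λ _ → f []
  ∑words (suc k) P f = sum λ i → ∑words k (P ∘ (i ∷_)) (f ∘ (i ∷_))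

  -- The continuous part of the initial marking is always 0, so only the
  -- discrete part M₀ is recorded.
  record LFSPN : Set where
    field
      #Pd #Pc #T : ℕ
      nonEmpty   : 0 ℕ.< #Pd ℕ.+ #Pc ℕ.+ #T

    Pd : Set
    Pd = Fin #Pd

    Pc : Set
    Pc = Fin #Pc

    Tr : Set
    Tr = Fin #T

    Marking : Set
    Marking = Vec ℕ #Pd

    field
      W  : (Pd × Tr) ⊎ (Tr × Pd) → ℕ
      C  : (Pc × Tr) ⊎ (Tr × Pc) → Bool
      R  : ∀ arc → T (C arc) → Marking → ℝ≥0
      Ω  : Tr → Marking → ℝ>0
      L  : Tr → Act
      M₀ : Marking

    Ena : Marking → Pred Tr 0ℓ
    Ena M t = ∀ p → W (inj₁ (p , t)) ℕ.≤ lookup M p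

    -- Truncated subtraction is exact whenever t is enabled in M.
    fire : Tr → Marking → Marking
    fire t M = tabulate λ p → lookup M p ℕ.∸ W (inj₁ (p , t)) ℕ.+ W (inj₂ (t , p))

    _—[_]→_ : Marking → Tr → Marking → Set
    M —[ t ]→ M̃ = Ena M t × M̃ ≡ fire t M

    data Reachable : Pred Marking 0ℓ where
      initial : Reachable M₀
      step    : ∀ {M t M̃} → Reachable M → M —[ t ]→ M̃ → Reachable M̃

    -- The reachability proof is irrelevant, so that elements of DRS are
    -- markings and not markings paired with a firing history.
    DRS : Set
    DRS = [ M ∈ Marking ∣ Reachable M ]

    initialState : DRS
    initialState = record { value = M₀ ; proof = irr.[ initial ] }

    rate : Tr → Marking → Carrier
    rate t M = proj₁ (Ω t M)

    exitRate : Marking → Carrier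
    exitRate M = ∑ (Ena M) λ t _ → rate t M

    SJ : Marking → Carrier ⁺
    SJ M = go em
      where
      go : Dec (∃ (Ena M)) → Carrier ⁺
      go (yes _) = [ exitRate M ⁻¹ ]
      go (no  _) = ⊤⁺

    -- Meaningful only for t enabled in M.
    PT : Tr → Marking → Carrier
    PT t M = rate t M * exitRate M ⁻¹

    RP : Pc → Marking → Carrier
    RP q M =
      ∑ (λ t → Ena M t × T (C (inj₂ (t , q)))) (λ t (_ , c) → proj₁ (R (inj₂ (t , q)) c M))
      - ∑ (λ t → Ena M t × T (C (inj₁ (q , t)))) (λ t (_ , c) → proj₁ (R (inj₁ (q , t)) c M))

    RM : Act → Marking → Pred DRS 0ℓ → Carrier
    RM a M H =
      ∑ (λ t → (∃ λ M̃ → H M̃ × M —[ t ]→ value M̃) × L t ≡ a) λ t _ → rate t M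

    Firable : Marking → List Tr → Set
    Firable M []      = ⊤
    Firable M (t ∷ ϑ) = Ena M t × Firable (fire t M) ϑ

    -- The markings visited by ϑ from M, including M itself.
    visited : Marking → List Tr → List Marking
    visited M []      = M ∷ []
    visited M (t ∷ ϑ) = M ∷ visited (fire t M) ϑ

    PT* : Marking → List Tr → Carrier
    PT* M []      = 1#
    PT* M (t ∷ ϑ) = PT t M * PT* (fire t M) ϑ

  record LFSPN₁ : Set where
    field
      net    : LFSPN
    open LFSPN net public
    field
      q      : Pc
      only-q : ∀ p → p ≡ q

    -- Since ς consists of (finite) positive reals, no sequence visiting a
    -- marking of infinite sojourn time satisfies this predicate.
    TranSeq : List Act → List ℝ>0 → List Carrier → Pred (List Tr) 0ℓ
    TranSeq σ ς ϱ ϑ =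
      Firable M₀ ϑ
      × map L ϑ ≡ σ
      × Pointwise _≈⁺_ (map SJ (visited M₀ ϑ)) (map ([_] ∘ proj₁) ς)
      × Pointwise _≈_ (map (RP q) (visited M₀ ϑ)) ϱ

    -- Every ϑ in TranSeq σ ς ϱ has the length of σ.
    tracePT : List Act → List ℝ>0 → List Carrier → Carrier
    tracePT σ ς ϱ = ∑words (length σ) (TranSeq σ ς ϱ) (PT* M₀)

  infix 4 _≡fl_ _↔fl_

  _≡fl_ : LFSPN₁ → LFSPN₁ → Set
  N ≡fl N′ = ∀ σ ς ϱ → LFSPN₁.tracePT N σ ς ϱ ≈ LFSPN₁.tracePT N′ σ ς ϱ

  module _ (N N′ : LFSPN₁) where

    private
      module N  = LFSPN₁ N
      module N′ = LFSPN₁ N′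

    State : Set
    State = N.DRS ⊎ N′.DRS

    stateRP : State → Carrier
    stateRP (inj₁ M) = N.RP  N.q  (value M)
    stateRP (inj₂ M) = N′.RP N′.q (value M)

    stateRM : Act → State → Pred State 0ℓ → Carrier
    stateRM a (inj₁ M) H = N.RM  a (value M) (H ∘ inj₁)
    stateRM a (inj₂ M) H = N′.RM a (value M) (H ∘ inj₂)

    -- The equivalence classes of _∼_ are the predicates s ∼_, for s a state.
    record IsFluidBisimulation (_∼_ : Rel State 0ℓ) : Set where
      field
        isEquivalence : IsEquivalence _∼_
        initial       : inj₁ N.initialState ∼ inj₂ N′.initialState
        sameRP        : ∀ {s₁ s₂} → s₁ ∼ s₂ → stateRP s₁ ≈ stateRP s₂
        sameRM        : ∀ {s₁ s₂} → s₁ ∼ s₂ → ∀ s a →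
                        stateRM a s₁ (s ∼_) ≈ stateRM a s₂ (s ∼_)

  _↔fl_ : LFSPN₁ → LFSPN₁ → Set₁
  N ↔fl N′ = ∃ (IsFluidBisimulation N N′)

{-# OPTIONS --safe #-}
module Submission where

-- A trace probability satisfies a recursion over the first step, in which the
-- probabilities of the remaining trace are weighted by the transition rates.
-- Inductively the remaining probability is constant on bisimilarity classes,
-- so the weighted sum depends only on the total rate into each class, which
-- bisimilar states share; the same argument with the constant 1 gives equal
-- exit rates and hence equal sojourn times.
--
-- For strictness, Act may be a singleton, so labels cannot separate the nets.
-- Tokens on one place count down from 3, by one (A) or two (B), without fluid;
-- every nonempty marking has exit rate α + β. No trace visits the dead marking
-- 0, as its sojourn time is infinite. Hence the one-step trace has probability
-- 1, and two steps must follow 3 → 2 → 1, with probability αβ / (α + β)².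
-- Exchanging α and β preserves this, but exchanges the rates of 3 → 2 and 3 → 1.

open import Defs
open import Axiom.ExcludedMiddle using (ExcludedMiddle)
open import Data.Bool.Base using (Bool; true; false; T)
open import Data.Empty using (⊥; ⊥-elim)
open import Data.Fin.Base using (Fin; zero; suc; splitAt)
open import Data.Irrelevant as irr using ()
open import Data.List.Base using (List; []; _∷_; length; map)
open import Data.List.Properties using (∷-injective)
open import Data.List.Relation.Binary.Pointwise using (Pointwise; []; _∷_)
open import Data.Nat.Base as ℕ using (ℕ; zero; suc)
open import Data.Product.Base using (Σ-syntax; ∃; ∃₂; _×_; _,_; proj₁; proj₂)
open import Data.Refinement using (Refinement; value)
open import Data.Sum.Base as Sum using (_⊎_; inj₁; inj₂)
open import Data.Unit.Base using (tt)
open import Data.Vec.Base using (Vec; []; _∷_)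
open import Function.Base using (_∘_; id)
open import Level using (0ℓ)
open import Relation.Binary.Core using (Rel)
open import Relation.Binary.PropositionalEquality.Core as ≡ using (_≡_)
open import Relation.Binary.Structures using (IsEquivalence; IsTotalOrder)
open import Relation.Nullary.Construct.Add.Supremum using (⊤⁺; [_])
open import Relation.Nullary.Decidable.Core using (Dec; yes; no)
open import Relation.Nullary.Negation.Core using (¬_)
open import Relation.Unary using (Pred)

import Algebra.Properties.Ring as RingProperties
import Algebra.Properties.Semiring.Sum as SemiringSum
import Relation.Binary.Construct.Add.Supremum.Equality as AddSup
import Relation.Binary.Reasoning.Setoid as SetoidReasoning

module FluidEquivalences (em : ExcludedMiddle 0ℓ) (ℝ : CompleteOrderedField) (Act : Set) where

  open LFSPNs em ℝ Act
  open CompleteOrderedField ℝ hiding (zero)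
  open RingProperties ring using
    (-‿+-comm; -0#≈0#; -‿distribˡ-*; -‿involutive; -1*x≈-x; x+x≈x⇒x≈0; +-inverseˡ-unique)
  open SemiringSum semiring using
    (sum; sum-cong-≋; sum-replicate-zero; ∑-distrib-+; *-distribˡ-sum; *-distribʳ-sum)
  open IsTotalOrder isTotalOrder using (antisym; total; ≤-respˡ-≈; ≤-respʳ-≈)
    renaming (trans to ≤-trans; reflexive to ≤-reflexive)
  open AddSup _≈_ using (_≈⁺_; ⊤⁺≈⊤⁺; [_]; ≈⁺-sym; ≈⁺-trans)
  open SetoidReasoning setoid

  -- Values and sums restricted by a proposition.

  private variable
    P Q : Set
    x y : Carrier

  ite-yes : ∀ {f : P → Carrier} → P → (∀ p → f p ≈ x) → ite P f ≈ x
  ite-yes {P} p f≈x with em {P}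
  ... | yes p′ = f≈x p′
  ... | no  ¬p = ⊥-elim (¬p p)

  ite-no : ∀ {f : P → Carrier} → ¬ P → ite P f ≈ 0#
  ite-no {P} ¬p with em {P}
  ... | yes p = ⊥-elim (¬p p)
  ... | no  _ = refl

  ite-cong : ∀ {f : P → Carrier} {g : Q → Carrier} →
             (P → Q) → (Q → P) → (∀ p q → f p ≈ g q) → ite P f ≈ ite Q g
  ite-cong {P} to from f≈g with em {P}
  ... | yes p = sym (ite-yes (to p) (λ q → sym (f≈g p q)))
  ... | no ¬p = sym (ite-no (¬p ∘ from))

  guard : Set → Carrier → Carrier
  guard P x = ite P λ _ → x

  guard-yes : P → guard P x ≈ x
  guard-yes p = ite-yes p λ _ → refl

  guard-no : ¬ P → guard P x ≈ 0#
  guard-no = ite-no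

  guard-cong : x ≈ y → guard P x ≈ guard P y
  guard-cong x≈y = ite-cong id id λ _ _ → x≈y

  guard-0 : guard P 0# ≈ 0#
  guard-0 {P} with em {P}
  ... | yes _ = refl
  ... | no  _ = refl

  guard-× : guard (P × Q) x ≈ guard P (guard Q x)
  guard-× {P} {Q} with em {P}
  ... | yes p = ite-cong proj₂ (p ,_) λ _ _ → refl
  ... | no ¬p = ite-no (¬p ∘ proj₁)

  guard-+ : guard P (x + y) ≈ guard P x + guard P y
  guard-+ {P} with em {P}
  ... | yes _ = refl
  ... | no  _ = sym (+-identityʳ 0#)

  guard-neg : guard P (- x) ≈ - guard P x
  guard-neg {P} with em {P}
  ... | yes _ = refl
  ... | no  _ = sym -0#≈0#

  sum-cong : ∀ {n} {f g : Fin n → Carrier} → (∀ i → f i ≈ g i) → sum {n} f ≈ sum {n} g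
  sum-cong {n} = sum-cong-≋ {n}

  guard-*ˡ : ∀ c → guard P (c * x) ≈ c * guard P x
  guard-*ˡ {P} c with em {P}
  ... | yes _ = refl
  ... | no  _ = sym (zeroʳ c)

  sum-0 : ∀ {n} {f : Fin n → Carrier} → (∀ i → f i ≈ 0#) → sum {n} f ≈ 0#
  sum-0 {n} f≈0 = trans (sum-cong {n} f≈0) (sum-replicate-zero n)

  sum-neg : ∀ {n} (f : Fin n → Carrier) → sum (λ i → - f i) ≈ - sum f
  sum-neg {zero}  f = sym -0#≈0#
  sum-neg {suc n} f = trans (+-congˡ (sum-neg (f ∘ suc))) (-‿+-comm _ _)

  sum-guard : ∀ {n} (f : Fin n → Carrier) → sum (λ i → guard P (f i)) ≈ guard P (sum f)
  sum-guard {P} {n} f with em {P}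
  ... | yes _ = refl
  ... | no  _ = sum-0 {n} λ _ → refl

  -- Lets two families of different sizes be handled as a single one in `equal-classSums`.
  sum-splitAt : ∀ m {n} (h : Fin m ⊎ Fin n → Carrier) →
                sum (h ∘ splitAt m) ≈ sum (h ∘ inj₁) + sum (h ∘ inj₂)
  sum-splitAt zero    h = sym (+-identityˡ _)
  sum-splitAt (suc m) h =
    trans (+-congˡ (sum-splitAt m (h ∘ Sum.map₁ suc))) (sym (+-assoc _ _ _))

  -- Weighted sums of a class-invariant function.

  module _ {K : Set} {_~_ : Rel K 0ℓ} (~-isEquivalence : IsEquivalence _~_)
           {g : K → Carrier} (g-resp : ∀ {k k′} → k ~ k′ → g k ≈ g k′) where

    private module ~ = IsEquivalence ~-isEquivalence

    -- With transitions as indices, rates as weights, and label and target as key, this is the rate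
    -- `RM` into an equivalence class.
    classSum : ∀ {n} (key : Fin n → K) (w : Fin n → Carrier) → K → Carrier
    classSum key w k = sum λ i → guard (k ~ key i) (w i)

    -- Induction on n: the class of the first key contributes 0 as a whole, so
    -- its weights may be replaced by 0, whereupon the first key can be dropped.
    vanishing-classSums : ∀ {n} (key : Fin n → K) (w : Fin n → Carrier) →
      (∀ k → classSum key w k ≈ 0#) → sum (λ i → w i * g (key i)) ≈ 0#
    vanishing-classSums {zero}  key w cs≈0 = refl
    vanishing-classSums {suc n} key w cs≈0 = begin
      sum (λ i → w i * g (key i))
        ≈⟨ sum-cong {suc n} split ⟩
      sum (λ i → guard (k₀ ~ key i) (w i) * g k₀ + w₁ i * g (key i))
        ≈⟨ ∑-distrib-+ (λ i → guard (k₀ ~ key i) (w i) * g k₀) (λ i → w₁ i * g (key i)) ⟩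
      sum (λ i → guard (k₀ ~ key i) (w i) * g k₀) + sum (λ i → w₁ i * g (key i))
        ≈⟨ +-congʳ (*-distribʳ-sum (g k₀) (λ i → guard (k₀ ~ key i) (w i))) ⟨
      classSum key w k₀ * g k₀ + sum (λ i → w₁ i * g (key i))
        ≈⟨ +-cong (trans (*-congʳ (cs≈0 k₀)) (zeroˡ _))
                  (+-cong (trans (*-congʳ (guard-no λ ¬r → ¬r ~.refl)) (zeroˡ _))
                          (vanishing-classSums (key ∘ suc) (w₁ ∘ suc) cs₁≈0)) ⟩
      0# + (0# + 0#)
        ≈⟨ trans (+-identityˡ _) (+-identityˡ _) ⟩
      0# ∎
      where
      k₀ = key zero

      w₁ : Fin (suc n) → Carrier
      w₁ i = guard (¬ (k₀ ~ key i)) (w i)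

      split : ∀ i → w i * g (key i) ≈ guard (k₀ ~ key i) (w i) * g k₀ + w₁ i * g (key i)
      split i with em {k₀ ~ key i}
      ... | yes r = sym (trans (+-cong (*-congˡ (g-resp r)) (trans (*-congʳ (guard-no λ ¬r → ¬r r)) (zeroˡ _)))
                               (+-identityʳ _))
      ... | no ¬r = sym (trans (+-cong (zeroˡ _) (*-congʳ (guard-yes ¬r))) (+-identityˡ _))

      cs₁≈0 : ∀ k → classSum (key ∘ suc) (w₁ ∘ suc) k ≈ 0#
      -- In the class of `k₀` all new weights are 0; in any other class they are the old ones, and
      -- the first key contributes nothing.
      cs₁≈0 k with em {k ~ k₀}
      ... | yes r = sum-0 {n} λ i → trans (sym guard-×) (guard-no λ (s , ¬t) → ¬t (~.trans (~.sym r) s))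
      ... | no ¬r = begin
        sum (λ i → guard (k ~ key (suc i)) (w₁ (suc i)))
          ≈⟨ sum-cong {n} (λ i → trans (sym guard-×)
               (ite-cong proj₁ (λ s → s , λ t → ¬r (~.trans s (~.sym t))) λ _ _ → refl)) ⟩
        sum (λ i → guard (k ~ key (suc i)) (w (suc i)))
          ≈⟨ +-identityˡ _ ⟨
        0# + sum (λ i → guard (k ~ key (suc i)) (w (suc i)))
          ≈⟨ +-congʳ (guard-no ¬r) ⟨
        classSum key w k
          ≈⟨ cs≈0 k ⟩
        0# ∎

    -- Joining the first family to the second with negated weights gives a single family whose class
    -- sums all vanish, so `vanishing-classSums` applies to the difference.
    equal-classSums : ∀ {m n} (key : Fin m → K) (w : Fin m → Carrier)
                              (key′ : Fin n → K) (w′ : Fin n → Carrier) →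
      (∀ k → classSum key w k ≈ classSum key′ w′ k) →
      sum (λ i → w i * g (key i)) ≈ sum (λ j → w′ j * g (key′ j))
    equal-classSums {m} {n} key w key′ w′ cs≈cs′ = begin
      S                ≈⟨ +-inverseˡ-unique S (- S′) S-S′≈0 ⟩
      - - S′           ≈⟨ -‿involutive S′ ⟩
      S′               ∎
      where
      S  = sum λ i → w i * g (key i)
      S′ = sum λ j → w′ j * g (key′ j)

      keys : Fin m ⊎ Fin n → K
      keys = Sum.[ key , key′ ]

      weights : Fin m ⊎ Fin n → Carrier
      weights = Sum.[ w , -_ ∘ w′ ]

      weights-vanish : ∀ k → classSum (keys ∘ splitAt m) (weights ∘ splitAt m) k ≈ 0#
      weights-vanish k = begin
        classSum (keys ∘ splitAt m) (weights ∘ splitAt m) k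
          ≈⟨ sum-splitAt m (λ i → guard (k ~ keys i) (weights i)) ⟩
        classSum key w k + sum (λ j → guard (k ~ key′ j) (- w′ j))
          ≈⟨ +-congˡ (trans (sum-cong {n} λ _ → guard-neg) (sum-neg λ j → guard (k ~ key′ j) (w′ j))) ⟩
        classSum key w k - classSum key′ w′ k
          ≈⟨ +-congʳ (cs≈cs′ k) ⟩
        classSum key′ w′ k - classSum key′ w′ k
          ≈⟨ -‿inverseʳ _ ⟩
        0# ∎

      S-S′≈0 : S - S′ ≈ 0#
      S-S′≈0 = begin
        S - S′
          ≈⟨ +-congˡ (sum-neg λ j → w′ j * g (key′ j)) ⟨
        S + sum (λ j → - (w′ j * g (key′ j)))
          ≈⟨ +-congˡ (sum-cong {n} λ j → -‿distribˡ-* (w′ j) (g (key′ j))) ⟩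
        S + sum (λ j → - w′ j * g (key′ j))
          ≈⟨ sum-splitAt m (λ i → weights i * g (keys i)) ⟨
        sum (λ i → weights (splitAt m i) * g (keys (splitAt m i)))
          ≈⟨ vanishing-classSums (keys ∘ splitAt m) (weights ∘ splitAt m) weights-vanish ⟩
        0# ∎

  -- Sums over words.

  ∑words-cong : ∀ k {n} {P Q : Pred (List (Fin n)) 0ℓ} {f g} →
    (∀ w → P w → Q w) → (∀ w → Q w → P w) → (∀ w → f w ≈ g w) →
    ∑words k P f ≈ ∑words k Q g
  ∑words-cong zero    to from f≈g = ite-cong (to []) (from []) λ _ _ → f≈g []
  ∑words-cong (suc k) to from f≈g = sum-cong λ i →
    ∑words-cong k (λ w → to (i ∷ w)) (λ w → from (i ∷ w)) (λ w → f≈g (i ∷ w))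

  ∑words-∅ : ∀ k {n} {P : Pred (List (Fin n)) 0ℓ} {f} → (∀ w → ¬ P w) → ∑words k P f ≈ 0#
  ∑words-∅ zero    ¬P = ite-no (¬P [])
  ∑words-∅ (suc k) ¬P = sum-0 λ i → ∑words-∅ k λ w → ¬P (i ∷ w)

  ∑words-*ˡ : ∀ k {n} {P : Pred (List (Fin n)) 0ℓ} {f} c →
    ∑words k P (λ w → c * f w) ≈ c * ∑words k P f
  ∑words-*ˡ zero {P = P} c with em {P []}
  ... | yes _ = refl
  ... | no  _ = sym (zeroʳ c)
  ∑words-*ˡ (suc k) {n} {P} {f} c =
    trans (sum-cong {n} λ i → ∑words-*ˡ k c)
          (sym (*-distribˡ-sum c λ i → ∑words k (P ∘ (i ∷_)) (f ∘ (i ∷_))))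

  ∑words-guard : ∀ k {n} {A : Set} {P : Pred (List (Fin n)) 0ℓ} {f} →
    ∑words k (λ w → A × P w) f ≈ guard A (∑words k P f)
  ∑words-guard k {A = A} with em {A}
  ... | yes a = ∑words-cong k (λ _ → proj₂) (λ _ → a ,_) λ _ → refl
  ... | no ¬a = ∑words-∅ k λ _ → ¬a ∘ proj₁

  -- Positivity in the ordered field.

  <-respʳ-≈ : x ≈ y → 0# < x → 0# < y
  <-respʳ-≈ x≈y (0≤x , 0≉x) = ≤-respʳ-≈ x≈y 0≤x , λ 0≈y → 0≉x (trans 0≈y (sym x≈y))

  +-nonNeg : 0# ≤ x → 0# ≤ y → 0# ≤ x + y
  +-nonNeg {x} {y} 0≤x 0≤y =
    ≤-trans 0≤y (≤-respˡ-≈ (+-identityˡ y) (+-monoˡ-≤ y 0≤x))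

  +-pos : 0# < x → 0# ≤ y → 0# < x + y
  +-pos {x} {y} (0≤x , 0≉x) 0≤y = +-nonNeg 0≤x 0≤y , λ 0≈x+y →
    0≉x (antisym 0≤x (≤-respʳ-≈ (trans (+-comm y x) (sym 0≈x+y))
                                (≤-respˡ-≈ (+-identityˡ x) (+-monoˡ-≤ x 0≤y))))

  0<1 : 0# < 1#
  0<1 with total 0# 1#
  ... | inj₁ 0≤1 = 0≤1 , 1≉0 ∘ sym
  -- Even here 1 is nonnegative, being the square of the nonnegative element -1.
  ... | inj₂ 1≤0 = ≤-respʳ-≈ -1*-1≈1 (*-nonNeg 0≤-1 0≤-1) , 1≉0 ∘ sym
    where
    0≤-1 : 0# ≤ - 1#
    0≤-1 = ≤-respˡ-≈ (-‿inverseʳ 1#) (≤-respʳ-≈ (+-identityˡ _) (+-monoˡ-≤ (- 1#) 1≤0))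

    -1*-1≈1 : - 1# * - 1# ≈ 1#
    -1*-1≈1 = trans (-1*x≈-x (- 1#)) (-‿involutive 1#)

  sum-nonNeg : ∀ {n} {f : Fin n → Carrier} → (∀ i → 0# ≤ f i) → 0# ≤ sum f
  sum-nonNeg {zero}  0≤f = ≤-reflexive refl
  sum-nonNeg {suc n} 0≤f = +-nonNeg (0≤f zero) (sum-nonNeg (0≤f ∘ suc))

  sum-pos : ∀ {n} {f : Fin n → Carrier} → (∀ i → 0# ≤ f i) → ∀ i → 0# < f i → 0# < sum f
  sum-pos 0≤f zero    0<f = +-pos 0<f (sum-nonNeg (0≤f ∘ suc))
  sum-pos 0≤f (suc i) 0<f = <-respʳ-≈ (+-comm _ _) (+-pos (sum-pos (0≤f ∘ suc) i 0<f) (0≤f zero))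

  guard-nonNeg : 0# ≤ x → 0# ≤ guard P x
  guard-nonNeg {P = P} 0≤x with em {P}
  ... | yes _ = 0≤x
  ... | no  _ = ≤-reflexive refl

  -- Trace probabilities and rates within one net.

  module Net (N : LFSPN₁) where
    open LFSPN₁ N

    live⇒0<exitRate : ∀ M → ∃ (Ena M) → 0# < exitRate M
    live⇒0<exitRate M (t , e) = sum-pos (λ u → guard-nonNeg (proj₁ (proj₂ (Ω u M)))) t
      (<-respʳ-≈ (sym (guard-yes e)) (proj₂ (Ω t M)))

    dead⇒exitRate≈0 : ∀ M → ¬ ∃ (Ena M) → exitRate M ≈ 0#
    dead⇒exitRate≈0 M dead = sum-0 λ t → ite-no λ e → dead (t , e)

    SJ-dead : ∀ M → ¬ ∃ (Ena M) → SJ M ≡ ⊤⁺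
    SJ-dead M dead with em {∃ (Ena M)}
    ... | yes live = ⊥-elim (dead live)
    ... | no  _    = ≡.refl

    -- The start is arbitrary so that induction can follow a trace; at `M₀` this and `trace` unfold
    -- to `TranSeq` and `tracePT`.
    TranSeqFrom : Marking → List Act → List ℝ>0 → List Carrier → Pred (List Tr) 0ℓ
    TranSeqFrom M σ ς ϱ ϑ =
      Firable M ϑ
      × map L ϑ ≡ σ
      × Pointwise _≈⁺_ (map SJ (visited M ϑ)) (map ([_] ∘ proj₁) ς)
      × Pointwise _≈_ (map (RP q) (visited M ϑ)) ϱ

    trace : Marking → List Act → List ℝ>0 → List Carrier → Carrier
    trace M σ ς ϱ = ∑words (length σ) (TranSeqFrom M σ ς ϱ) (PT* M)

    RM-dead : ∀ a M H → ¬ ∃ (Ena M) → RM a M H ≈ 0#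
    RM-dead a M H dead = sum-0 {#T} λ t → ite-no λ ((_ , _ , e , _) , _) → dead (t , e)

    RP-noArcs : (∀ arc → ¬ T (C arc)) → ∀ M → RP q M ≈ 0#
    RP-noArcs ¬C M = trans
      (+-cong (sum-0 {#T} λ _ → ite-no (¬C _ ∘ proj₂)) (-‿cong (sum-0 {#T} λ _ → ite-no (¬C _ ∘ proj₂))))
      (-‿inverseʳ 0#)

    -- The first sojourn time is infinite, whereas `ς` prescribes finite ones, so the sum has no
    -- terms.
    trace-dead : ∀ M → ¬ ∃ (Ena M) → ∀ σ ς ϱ → trace M σ ς ϱ ≈ 0#
    trace-dead M dead σ ς ϱ = ∑words-∅ (length σ) λ ϑ (_ , _ , js , _) → noSJ ϑ ς js
      where
      SJ≢ : ∀ {x} → ¬ (SJ M ≈⁺ [ x ])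
      SJ≢ j with ≡.subst (_≈⁺ _) (SJ-dead M dead) j
      ... | ()

      noSJ : ∀ ϑ ς → ¬ Pointwise _≈⁺_ (map SJ (visited M ϑ)) (map ([_] ∘ proj₁) ς)
      noSJ []      (_ ∷ _) (j ∷ _) = SJ≢ j
      noSJ (_ ∷ _) (_ ∷ _) (j ∷ _) = SJ≢ j

    Observed : Marking → ℝ>0 → Carrier → Set
    Observed M x r = SJ M ≈⁺ [ proj₁ x ] × RP q M ≈ r

    trace-noSJ : ∀ M a σ ϱ → trace M (a ∷ σ) [] ϱ ≈ 0#
    trace-noSJ M a σ ϱ = sum-0 {#T} λ t → ∑words-∅ (length σ) λ { _ (_ , _ , () , _) }

    trace-noRP : ∀ M a σ ς → trace M (a ∷ σ) ς [] ≈ 0#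
    trace-noRP M a σ ς = sum-0 {#T} λ t → ∑words-∅ (length σ) λ { _ (_ , _ , _ , ()) }

    -- The conditions on a word split into those on its first transition, those on the observation
    -- of `M`, and exactly the conditions on its tail from `fire t M`.
    trace-∷ : ∀ M a σ x ς r ϱ →
      trace M (a ∷ σ) (x ∷ ς) (r ∷ ϱ) ≈
      guard (Observed M x r)
        (sum λ t → guard (Ena M t × L t ≡ a) (PT t M * trace (fire t M) σ ς ϱ))
    trace-∷ M a σ x ς r ϱ = begin
      trace M (a ∷ σ) (x ∷ ς) (r ∷ ϱ)
        ≈⟨ sum-cong firstStep ⟩
      sum (λ t → guard (Observed M x r) (guard (Ena M t × L t ≡ a) (PT t M * trace (fire t M) σ ς ϱ)))
        ≈⟨ sum-guard (λ t → guard (Ena M t × L t ≡ a) (PT t M * trace (fire t M) σ ς ϱ)) ⟩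
      guard (Observed M x r)
        (sum λ t → guard (Ena M t × L t ≡ a) (PT t M * trace (fire t M) σ ς ϱ)) ∎
      where
      firstStep : ∀ t →
        ∑words (length σ) (λ ϑ → TranSeqFrom M (a ∷ σ) (x ∷ ς) (r ∷ ϱ) (t ∷ ϑ)) (λ ϑ → PT* M (t ∷ ϑ)) ≈
        guard (Observed M x r) (guard (Ena M t × L t ≡ a) (PT t M * trace (fire t M) σ ς ϱ))
      firstStep t = begin
        ∑words (length σ) (λ ϑ → TranSeqFrom M (a ∷ σ) (x ∷ ς) (r ∷ ϱ) (t ∷ ϑ)) (λ ϑ → PT* M (t ∷ ϑ))
          ≈⟨ ∑words-cong (length σ)
               (λ { ϑ ((e , f) , l , (s ∷ ss) , (p ∷ ps)) →
                    ((s , p) , e , proj₁ (∷-injective l)) , f , proj₂ (∷-injective l) , ss , ps })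
               (λ { ϑ (((s , p) , e , ≡.refl) , f , ≡.refl , ss , ps) →
                    (e , f) , ≡.refl , (s ∷ ss) , (p ∷ ps) })
               (λ _ → refl) ⟩
        ∑words (length σ)
          (λ ϑ → (Observed M x r × Ena M t × L t ≡ a) × TranSeqFrom (fire t M) σ ς ϱ ϑ)
          (λ ϑ → PT t M * PT* (fire t M) ϑ)
          ≈⟨ ∑words-guard (length σ) ⟩
        guard (Observed M x r × Ena M t × L t ≡ a)
          (∑words (length σ) (TranSeqFrom (fire t M) σ ς ϱ) (λ ϑ → PT t M * PT* (fire t M) ϑ))
          ≈⟨ guard-cong (∑words-*ˡ (length σ) (PT t M)) ⟩
        guard (Observed M x r × Ena M t × L t ≡ a) (PT t M * trace (fire t M) σ ς ϱ)
          ≈⟨ guard-× ⟩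
        guard (Observed M x r) (guard (Ena M t × L t ≡ a) (PT t M * trace (fire t M) σ ς ϱ)) ∎

    fired : (M : DRS) (t : Tr) → Ena (value M) t → DRS
    fired M t e = record
      { value = fire t (value M)
      ; proof = irr.map (λ reachable → step reachable (e , ≡.refl)) (Refinement.proof M)
      }

    -- Firing is deterministic and reachability proofs are irrelevant, so the only possible target
    -- state is `fired M t e` itself.
    RM-fired : ∀ a M H → RM a (value M) H ≈
      sum λ t → guard (Σ[ e ∈ Ena (value M) t ] H (fired M t e) × L t ≡ a) (rate t (value M))
    RM-fired a M H = sum-cong {#T} λ t → ite-cong
      (λ { ((_ , h , e , ≡.refl) , l) → e , h , l })
      (λ { (e , h , l) → (fired M t e , h , e , ≡.refl) , l })
      λ _ _ → refl

    -- Extended by 0 to disabled transitions, so that sums over all of `Tr` carry no enabling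
    -- proofs.
    flow : DRS → Tr → Carrier
    flow M t = guard (Ena (value M) t) (rate t (value M))

    -- If t is not enabled in M, the junk value M is harmless, as flow M t ≈ 0#.
    next : DRS → Tr → DRS
    next M t with em {Ena (value M) t}
    ... | yes e = fired M t e
    ... | no  _ = M

    next-fired : ∀ M t (e : Ena (value M) t) → next M t ≡ fired M t e
    next-fired M t e with em {Ena (value M) t}
    ... | yes _ = ≡.refl
    ... | no ¬e = ⊥-elim (¬e e)

    -- Brings `RM` into the shape of a `classSum` with weights `flow M t`, the key of `t` being its
    -- label and its target.
    RM-flow : ∀ a M H → RM a (value M) H ≈
      sum λ t → guard (L t ≡ a × H (next M t)) (flow M t)
    RM-flow a M H = trans (RM-fired a M H) (sum-cong {#T} λ t → trans
      (ite-cong (λ (e , h , l) → (l , ≡.subst H (≡.sym (next-fired M t e)) h) , e)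
                (λ ((l , h) , e) → e , ≡.subst H (next-fired M t e) h , l)
                λ _ _ → refl)
      guard-×)

    -- All the `PT t` share the factor `exitRate ⁻¹`; pulling it out leaves the same weights as in
    -- `RM-flow`, multiplied by a function of label and target alone.
    trace-flow : ∀ M a σ x ς r ϱ →
      trace (value M) (a ∷ σ) (x ∷ ς) (r ∷ ϱ) ≈
      guard (Observed (value M) x r)
        (exitRate (value M) ⁻¹ *
         sum λ t → flow M t * guard (L t ≡ a) (trace (value (next M t)) σ ς ϱ))
    trace-flow M a σ x ς r ϱ = trans (trace-∷ (value M) a σ x ς r ϱ) (guard-cong (begin
      sum (λ t → guard (Ena (value M) t × L t ≡ a) (PT t (value M) * trace (fire t (value M)) σ ς ϱ))
        ≈⟨ sum-cong term ⟩
      sum (λ t → exitRate (value M) ⁻¹ * (flow M t * g t))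
        ≈⟨ *-distribˡ-sum (exitRate (value M) ⁻¹) (λ t → flow M t * g t) ⟨
      exitRate (value M) ⁻¹ * sum (λ t → flow M t * g t) ∎))
      where
      g : Tr → Carrier
      g t = guard (L t ≡ a) (trace (value (next M t)) σ ς ϱ)

      term : ∀ t → guard (Ena (value M) t × L t ≡ a) (PT t (value M) * trace (fire t (value M)) σ ς ϱ) ≈
                   exitRate (value M) ⁻¹ * (flow M t * g t)
      term t = by-cases em em
        where
        by-cases : Dec (Ena (value M) t) → Dec (L t ≡ a) → _
        by-cases (no ¬e) _ = trans (guard-no (¬e ∘ proj₁)) (sym (trans
          (*-congˡ (trans (*-congʳ (guard-no ¬e)) (zeroˡ _))) (zeroʳ _)))
        by-cases (yes _) (no ¬l) = trans (guard-no (¬l ∘ proj₂)) (sym (trans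
          (*-congˡ (trans (*-congˡ (guard-no ¬l)) (zeroʳ _))) (zeroʳ _)))
        by-cases (yes e) (yes l) = begin
          guard (Ena (value M) t × L t ≡ a) (PT t (value M) * trace (fire t (value M)) σ ς ϱ)
            ≈⟨ guard-yes (e , l) ⟩
          rate t (value M) * exitRate (value M) ⁻¹ * trace (fire t (value M)) σ ς ϱ
            ≈⟨ trans (*-congʳ (*-comm _ _)) (*-assoc _ _ _) ⟩
          exitRate (value M) ⁻¹ * (rate t (value M) * trace (fire t (value M)) σ ς ϱ)
            ≡⟨ ≡.cong (λ M̃ → exitRate (value M) ⁻¹ * (rate t (value M) * trace (value M̃) σ ς ϱ))
                      (next-fired M t e) ⟨
          exitRate (value M) ⁻¹ * (rate t (value M) * trace (value (next M t)) σ ς ϱ)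
            ≈⟨ *-congˡ (*-cong (guard-yes e) (guard-yes l)) ⟨
          exitRate (value M) ⁻¹ * (flow M t * g t) ∎

  -- Comparing observations across two nets.

  module _ (N N′ : LFSPN₁) where
    private
      module N  = LFSPN₁ N
      module N′ = LFSPN₁ N′
      module Net-N  = Net N
      module Net-N′ = Net N′

    -- The exit rate is positive at live markings and 0 at dead ones, so it also determines when the
    -- sojourn time is infinite.
    SJ-cong : ∀ {M M′} → N.exitRate M ≈ N′.exitRate M′ → N.SJ M ≈⁺ N′.SJ M′
    SJ-cong {M} {M′} e≈e′ with em {∃ (N.Ena M)} | em {∃ (N′.Ena M′)}
    ... | yes live | yes live′ = [ ⁻¹-cong e≈e′ ]
    ... | no  _    | no  _     = ⊤⁺≈⊤⁺
    ... | yes live | no  dead′ = ⊥-elim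
      (proj₂ (Net-N.live⇒0<exitRate M live) (sym (trans e≈e′ (Net-N′.dead⇒exitRate≈0 M′ dead′))))
    ... | no  dead | yes live′ = ⊥-elim
      (proj₂ (Net-N′.live⇒0<exitRate M′ live′) (trans (sym (Net-N.dead⇒exitRate≈0 M dead)) e≈e′))

    module _ {M M′} (exitRate≈ : N.exitRate M ≈ N′.exitRate M′) (RP≈ : N.RP N.q M ≈ N′.RP N′.q M′) where

      Observed-cong : ∀ {x r} → Net-N.Observed M x r → Net-N′.Observed M′ x r
      Observed-cong (j , p) =
        ≈⁺-trans trans (≈⁺-sym sym (SJ-cong exitRate≈)) j , trans (sym RP≈) p

      TranSeqFrom-[]-cong : ∀ {ς ϱ} → Net-N.TranSeqFrom M [] ς ϱ [] → Net-N′.TranSeqFrom M′ [] ς ϱ []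
      TranSeqFrom-[]-cong {x ∷ []} {r ∷ []} (_ , _ , (j ∷ []) , (p ∷ [])) with Observed-cong {x} {r} (j , p)
      ... | j′ , p′ = tt , ≡.refl , (j′ ∷ []) , (p′ ∷ [])

  trace-[]-cong : ∀ N N′ {M M′} ς ϱ →
    LFSPN₁.exitRate N M ≈ LFSPN₁.exitRate N′ M′ →
    LFSPN₁.RP N (LFSPN₁.q N) M ≈ LFSPN₁.RP N′ (LFSPN₁.q N′) M′ →
    Net.trace N M [] ς ϱ ≈ Net.trace N′ M′ [] ς ϱ
  trace-[]-cong N N′ ς ϱ e p = ite-cong
    (TranSeqFrom-[]-cong N N′ e p) (TranSeqFrom-[]-cong N′ N (sym e) (sym p)) λ _ _ → refl

  -- Bisimilar states have equal trace probabilities.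

  module Bisimilar (N N′ : LFSPN₁) {_∼_ : Rel (State N N′) 0ℓ}
                   (isBisimulation : IsFluidBisimulation N N′ _∼_) where
    private S = State N N′

    open IsFluidBisimulation isBisimulation renaming (isEquivalence to ∼-isEquivalence)
    private module ∼ = IsEquivalence ∼-isEquivalence

    -- Selecting the net by the state allows statements about any two states, without four cases for
    -- the nets they belong to.
    netOf : S → LFSPN₁
    netOf (inj₁ _) = N
    netOf (inj₂ _) = N′

    private
      module At (s : S) where
        open LFSPN₁ (netOf s) public
        open Net (netOf s) public

    markingOf : ∀ s → At.DRS s
    markingOf (inj₁ M) = M
    markingOf (inj₂ M) = M

    sibling : ∀ s → At.DRS s → S
    sibling (inj₁ _) = inj₁
    sibling (inj₂ _) = inj₂

    weight : ∀ s → At.Tr s → Carrier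
    weight s = At.flow s (markingOf s)

    key : ∀ s → At.Tr s → Act × S
    key s t = At.L s t , sibling s (At.next s (markingOf s) t)

    stateExitRate : S → Carrier
    stateExitRate s = At.exitRate s (value (markingOf s))

    stateTrace : S → List Act → List ℝ>0 → List Carrier → Carrier
    stateTrace s = At.trace s (value (markingOf s))

    -- The label equation is reversed so that `(a , u) ≋ key s t` unfolds to the condition of
    -- `RM-flow` for the class of `u`.
    _≋_ : Rel (Act × S) 0ℓ
    (a , s) ≋ (b , s′) = b ≡ a × s ∼ s′

    ≋-isEquivalence : IsEquivalence _≋_
    ≋-isEquivalence = record
      { refl  = ≡.refl , ∼.refl
      ; sym   = λ (a , r) → ≡.sym a , ∼.sym r
      ; trans = λ (a , r) (b , r′) → ≡.trans b a , ∼.trans r r′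
      }

    -- `sameRM` says precisely that the class sums of the two families of transitions agree.
    flow-resp : ∀ {s s′} (g : Act × S → Carrier) → (∀ {k k′} → k ≋ k′ → g k ≈ g k′) → s ∼ s′ →
      sum (λ t → weight s t * g (key s t)) ≈ sum (λ t → weight s′ t * g (key s′ t))
    flow-resp {s} {s′} g g-resp s∼s′ =
      equal-classSums ≋-isEquivalence {g = g} g-resp (key s) (weight s) (key s′) (weight s′)
        λ (a , u) → trans (sym (stateRM-flow s a u)) (trans (sameRM s∼s′ u a) (stateRM-flow s′ a u))
      where
      stateRM-flow : ∀ s a u → stateRM N N′ a s (u ∼_) ≈
                     sum λ t → guard ((a , u) ≋ key s t) (weight s t)
      stateRM-flow (inj₁ M) a u = Net.RM-flow N a M _
      stateRM-flow (inj₂ M) a u = Net.RM-flow N′ a M _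

    exitRate-resp : ∀ {s s′} → s ∼ s′ → stateExitRate s ≈ stateExitRate s′
    exitRate-resp {s} {s′} s∼s′ = begin
      stateExitRate s                ≈⟨ sum-cong {At.#T s} (λ t → *-identityʳ _) ⟨
      sum (λ t → weight s t * 1#)    ≈⟨ flow-resp (λ _ → 1#) (λ _ → refl) s∼s′ ⟩
      sum (λ t → weight s′ t * 1#)   ≈⟨ sum-cong {At.#T s′} (λ t → *-identityʳ _) ⟩
      stateExitRate s′               ∎

    RP-resp : ∀ {s s′} → s ∼ s′ →
      At.RP s (At.q s) (value (markingOf s)) ≈ At.RP s′ (At.q s′) (value (markingOf s′))
    RP-resp {s} {s′} s∼s′ = begin
      At.RP s (At.q s) (value (markingOf s))    ≡⟨ stateRP≡ s ⟨
      stateRP N N′ s                            ≈⟨ sameRP s∼s′ ⟩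
      stateRP N N′ s′                           ≡⟨ stateRP≡ s′ ⟩
      At.RP s′ (At.q s′) (value (markingOf s′)) ∎
      where
      stateRP≡ : ∀ s → stateRP N N′ s ≡ At.RP s (At.q s) (value (markingOf s))
      stateRP≡ (inj₁ _) = ≡.refl
      stateRP≡ (inj₂ _) = ≡.refl

    StateObserved : S → ℝ>0 → Carrier → Set
    StateObserved s = At.Observed s (value (markingOf s))

    StateObserved-resp : ∀ {s s′ x r} → s ∼ s′ → StateObserved s x r → StateObserved s′ x r
    StateObserved-resp {s} {s′} {x} {r} s∼s′ =
      Observed-cong (netOf s) (netOf s′) (exitRate-resp {s} {s′} s∼s′) (RP-resp {s} {s′} s∼s′) {x} {r}

    stateTrace-∷ : ∀ s a σ x ς r ϱ →
      stateTrace s (a ∷ σ) (x ∷ ς) (r ∷ ϱ) ≈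
      guard (StateObserved s x r)
        (stateExitRate s ⁻¹ *
         sum λ t → weight s t * guard (proj₁ (key s t) ≡ a) (stateTrace (proj₂ (key s t)) σ ς ϱ))
    stateTrace-∷ (inj₁ M) = Net.trace-flow N M
    stateTrace-∷ (inj₂ M) = Net.trace-flow N′ M

    stateTrace-resp : ∀ σ ς ϱ {s s′} → s ∼ s′ → stateTrace s σ ς ϱ ≈ stateTrace s′ σ ς ϱ
    stateTrace-resp [] ς ϱ {s} {s′} s∼s′ =
      trace-[]-cong (netOf s) (netOf s′) ς ϱ (exitRate-resp {s} {s′} s∼s′) (RP-resp {s} {s′} s∼s′)
    stateTrace-resp (a ∷ σ) [] ϱ {s} {s′} _ =
      trans (At.trace-noSJ s _ a σ ϱ) (sym (At.trace-noSJ s′ _ a σ ϱ))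
    stateTrace-resp (a ∷ σ) (x ∷ ς) [] {s} {s′} _ =
      trans (At.trace-noRP s _ a σ (x ∷ ς)) (sym (At.trace-noRP s′ _ a σ (x ∷ ς)))
    stateTrace-resp (a ∷ σ) (x ∷ ς) (r ∷ ϱ) {s} {s′} s∼s′ = begin
      stateTrace s (a ∷ σ) (x ∷ ς) (r ∷ ϱ)
        ≈⟨ stateTrace-∷ s a σ x ς r ϱ ⟩
      guard (StateObserved s x r) (stateExitRate s ⁻¹ * sum λ t → weight s t * g (key s t))
        ≈⟨ ite-cong (StateObserved-resp {s} {s′} {x} {r} s∼s′) (StateObserved-resp {s′} {s} {x} {r} (∼.sym s∼s′))
             (λ _ _ → *-cong (⁻¹-cong (exitRate-resp {s} {s′} s∼s′)) (flow-resp g g-resp s∼s′)) ⟩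
      guard (StateObserved s′ x r) (stateExitRate s′ ⁻¹ * sum λ t → weight s′ t * g (key s′ t))
        ≈⟨ stateTrace-∷ s′ a σ x ς r ϱ ⟨
      stateTrace s′ (a ∷ σ) (x ∷ ς) (r ∷ ϱ) ∎
      where
      g : Act × S → Carrier
      g (b , u) = guard (b ≡ a) (stateTrace u σ ς ϱ)

      g-resp : ∀ {k k′} → k ≋ k′ → g k ≈ g k′
      -- The induction hypothesis for the remaining trace makes `g` invariant, as `flow-resp`
      -- demands.
      g-resp (≡.refl , u∼u′) = guard-cong (stateTrace-resp σ ς ϱ u∼u′)

  ↔fl⇒≡fl : ∀ N N′ → N ↔fl N′ → N ≡fl N′
  ↔fl⇒≡fl N N′ (_ , isBisimulation) σ ς ϱ =
    stateTrace-resp σ ς ϱ (IsFluidBisimulation.initial isBisimulation)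
    where open Bisimilar N N′ isBisimulation

  -- The countdown nets.

  module Countdown (a : Act) where

    pattern A = zero
    pattern B = suc zero

    -- At 3, A has rate α and B has rate β; at 2 the rates are exchanged.
    chain : ℝ>0 → ℝ>0 → LFSPN₁
    chain α β = record
      { net = record
        { #Pd      = 1
        ; #Pc      = 1
        ; #T       = 2
        ; nonEmpty = ℕ.s≤s ℕ.z≤n
        ; W        = W
        ; C        = λ _ → false
        ; R        = λ _ ()
        ; Ω        = Ω
        ; L        = λ _ → a
        ; M₀       = 3 ∷ []
        }
      ; q      = zero
      ; only-q = λ { zero → ≡.refl }
      }
      where
      W : (Fin 1 × Fin 2) ⊎ (Fin 2 × Fin 1) → ℕ
      W (inj₁ (_ , A)) = 1
      W (inj₁ (_ , B)) = 2
      W (inj₂ _)       = 0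

      Ω : Fin 2 → Vec ℕ 1 → ℝ>0
      Ω A (3 ∷ []) = α
      Ω A (2 ∷ []) = β
      -- At 1 only `A` is enabled, so it carries the whole rate α + β; this makes the exit rate
      -- there the same as at 3 and 2.
      Ω A (_ ∷ []) = proj₁ α + proj₁ β , +-pos (proj₂ α) (proj₁ (proj₂ β))
      Ω B (3 ∷ []) = β
      Ω B (_ ∷ []) = α

    module Run (α⁺ β⁺ : ℝ>0) where
      open LFSPN₁ (chain α⁺ β⁺) public
      open Net (chain α⁺ β⁺) public

      α β : Carrier
      α = proj₁ α⁺
      β = proj₁ β⁺

      A-enabled : ∀ n → Ena (suc n ∷ []) A
      A-enabled n zero = ℕ.s≤s ℕ.z≤n

      B-enabled : ∀ n → Ena (suc (suc n) ∷ []) B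
      B-enabled n zero = ℕ.s≤s (ℕ.s≤s ℕ.z≤n)

      B-disabled : ¬ Ena (1 ∷ []) B
      B-disabled e with e zero
      ... | ℕ.s≤s ()

      0-dead : ¬ ∃ (Ena (0 ∷ []))
      0-dead (A , e) with e zero
      ... | ()
      0-dead (B , e) with e zero
      ... | ()

      RP≈0 : ∀ M → RP q M ≈ 0#
      RP≈0 = RP-noArcs λ _ ()

      exitRate-3 : exitRate (3 ∷ []) ≈ α + β
      exitRate-3 = +-cong (guard-yes (A-enabled 2)) (trans (+-identityʳ _) (guard-yes (B-enabled 1)))

      exitRate-2 : exitRate (2 ∷ []) ≈ α + β
      exitRate-2 = trans (+-cong (guard-yes (A-enabled 1)) (trans (+-identityʳ _) (guard-yes (B-enabled 0))))
                         (+-comm β α)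

      exitRate-1 : exitRate (1 ∷ []) ≈ α + β
      exitRate-1 = trans (+-cong (guard-yes (A-enabled 0)) (trans (+-identityʳ _) (guard-no B-disabled)))
                         (+-identityʳ _)

      -- The common sojourn time at 3, 2 and 1, and so the factor that turns rates into
      -- probabilities.
      ν : Carrier
      ν = (α + β) ⁻¹

      -- Only `A` can fire at 1, and it leads to the dead marking 0.
      trace-1-∷ : ∀ b σ ς ϱ → trace (1 ∷ []) (b ∷ σ) ς ϱ ≈ 0#
      trace-1-∷ b σ []      ϱ       = trace-noSJ (1 ∷ []) b σ ϱ
      trace-1-∷ b σ (x ∷ ς) []      = trace-noRP (1 ∷ []) b σ (x ∷ ς)
      trace-1-∷ b σ (x ∷ ς) (r ∷ ϱ) = begin
        trace (1 ∷ []) (b ∷ σ) (x ∷ ς) (r ∷ ϱ)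
          ≈⟨ trace-∷ (1 ∷ []) b σ x ς r ϱ ⟩
        guard (Observed (1 ∷ []) x r) _
          ≈⟨ guard-cong (+-cong
               (trans (guard-cong (trans (*-congˡ (trace-dead (0 ∷ []) 0-dead σ ς ϱ)) (zeroʳ _))) guard-0)
               (trans (+-identityʳ _) (guard-no (B-disabled ∘ proj₁)))) ⟩
        guard (Observed (1 ∷ []) x r) (0# + 0#)
          ≈⟨ trans (guard-cong (+-identityʳ 0#)) guard-0 ⟩
        0# ∎

      -- `B` leads to the dead marking, so only the step `A` to 1 counts. Its rate β is pulled in
      -- front of the guards, ready to be exchanged with the α of the preceding step.
      trace-2-∷ : ∀ b σ x ς r ϱ → trace (2 ∷ []) (b ∷ σ) (x ∷ ς) (r ∷ ϱ) ≈
        β * guard (Observed (2 ∷ []) x r) (guard (a ≡ b) (ν * trace (1 ∷ []) σ ς ϱ))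
      trace-2-∷ b σ x ς r ϱ = begin
        trace (2 ∷ []) (b ∷ σ) (x ∷ ς) (r ∷ ϱ)
          ≈⟨ trace-∷ (2 ∷ []) b σ x ς r ϱ ⟩
        guard (Observed (2 ∷ []) x r) _
          ≈⟨ guard-cong (+-cong
               (ite-cong proj₂ (A-enabled 1 ,_) λ _ _ →
                 trans (*-congʳ (*-congˡ (⁻¹-cong exitRate-2))) (*-assoc β ν _))
               (trans (+-identityʳ _)
                 (trans (guard-cong (trans (*-congˡ (trace-dead (0 ∷ []) 0-dead σ ς ϱ)) (zeroʳ _))) guard-0))) ⟩
        guard (Observed (2 ∷ []) x r) (guard (a ≡ b) (β * (ν * trace (1 ∷ []) σ ς ϱ)) + 0#)
          ≈⟨ guard-cong (trans (+-identityʳ _) (guard-*ˡ β)) ⟩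
        guard (Observed (2 ∷ []) x r) (β * guard (a ≡ b) (ν * trace (1 ∷ []) σ ς ϱ))
          ≈⟨ guard-*ˡ β ⟩
        β * guard (Observed (2 ∷ []) x r) (guard (a ≡ b) (ν * trace (1 ∷ []) σ ς ϱ)) ∎

      trace-3-∷ : ∀ b σ x ς r ϱ → trace (3 ∷ []) (b ∷ σ) (x ∷ ς) (r ∷ ϱ) ≈
        guard (Observed (3 ∷ []) x r) (guard (a ≡ b)
          (α * ν * trace (2 ∷ []) σ ς ϱ + β * ν * trace (1 ∷ []) σ ς ϱ))
      trace-3-∷ b σ x ς r ϱ = begin
        trace (3 ∷ []) (b ∷ σ) (x ∷ ς) (r ∷ ϱ)
          ≈⟨ trace-∷ (3 ∷ []) b σ x ς r ϱ ⟩
        guard (Observed (3 ∷ []) x r) _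
          ≈⟨ guard-cong (+-cong
               (ite-cong proj₂ (A-enabled 2 ,_) λ _ _ → *-congʳ (*-congˡ (⁻¹-cong exitRate-3)))
               (trans (+-identityʳ _)
                 (ite-cong proj₂ (B-enabled 1 ,_) λ _ _ → *-congʳ (*-congˡ (⁻¹-cong exitRate-3))))) ⟩
        guard (Observed (3 ∷ []) x r)
          (guard (a ≡ b) (α * ν * trace (2 ∷ []) σ ς ϱ) + guard (a ≡ b) (β * ν * trace (1 ∷ []) σ ς ϱ))
          ≈⟨ guard-cong guard-+ ⟨
        guard (Observed (3 ∷ []) x r) (guard (a ≡ b)
          (α * ν * trace (2 ∷ []) σ ς ϱ + β * ν * trace (1 ∷ []) σ ς ϱ)) ∎

      -- Firing `B` at 3 or at 2 yields `D₁` or `D₀` as well, since the firing history is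
      -- irrelevant.
      D₃ D₂ D₁ D₀ : DRS
      D₃ = initialState
      D₂ = fired D₃ A (A-enabled 2)
      D₁ = fired D₂ A (A-enabled 1)
      D₀ = fired D₁ A (A-enabled 0)

      RM-3 : ∀ H → RM a (3 ∷ []) H ≈ guard (H D₂) α + guard (H D₁) β
      RM-3 H = trans (RM-fired a D₃ H) (+-cong
        (ite-cong (λ (_ , h , _) → h) (λ h → A-enabled 2 , h , ≡.refl) λ _ _ → refl)
        (trans (+-identityʳ _)
          (ite-cong (λ (_ , h , _) → h) (λ h → B-enabled 1 , h , ≡.refl) λ _ _ → refl)))

      RM-2 : ∀ H → RM a (2 ∷ []) H ≈ guard (H D₁) β + guard (H D₀) α
      RM-2 H = trans (RM-fired a D₂ H) (+-cong
        (ite-cong (λ (_ , h , _) → h) (λ h → A-enabled 1 , h , ≡.refl) λ _ _ → refl)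
        (trans (+-identityʳ _)
          (ite-cong (λ (_ , h , _) → h) (λ h → B-enabled 0 , h , ≡.refl) λ _ _ → refl)))

      RM-1 : ∀ H → RM a (1 ∷ []) H ≈ guard (H D₀) (α + β)
      RM-1 H = trans (RM-fired a D₁ H) (trans (+-cong
        (ite-cong (λ (_ , h , _) → h) (λ h → A-enabled 0 , h , ≡.refl) λ _ _ → refl)
        (trans (+-identityʳ _) (guard-no (B-disabled ∘ proj₁)))) (+-identityʳ _))

      RM-0 : ∀ H → RM a (0 ∷ []) H ≈ 0#
      RM-0 H = RM-dead a (0 ∷ []) H 0-dead

    -- Trace equivalence and non-bisimilarity under exchange of the rates.

    module _ (α⁺ β⁺ : ℝ>0) where
      private
        module R  = Run α⁺ β⁺
        module R′ = Run β⁺ α⁺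
        open R using (α; β)

      Observed-swap : ∀ n → R.exitRate (n ∷ []) ≈ α + β → R′.exitRate (n ∷ []) ≈ β + α →
                      ∀ x r {y} → guard (R.Observed (n ∷ []) x r) y ≈ guard (R′.Observed (n ∷ []) x r) y
      Observed-swap n e e′ x r = ite-cong
        (Observed-cong (chain α⁺ β⁺) (chain β⁺ α⁺) rates RPs {x} {r})
        (Observed-cong (chain β⁺ α⁺) (chain α⁺ β⁺) (sym rates) (sym RPs) {x} {r})
        λ _ _ → refl
        where
        rates = trans e (trans (+-comm α β) (sym e′))
        RPs   = trans (R.RP≈0 (n ∷ [])) (sym (R′.RP≈0 (n ∷ [])))

      ν-swap : R.ν ≈ R′.ν
      ν-swap = ⁻¹-cong (+-comm α β)

      -- The markings may differ because an empty trace sees only exit rate and fluid flow;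
      -- `mixture-swap` compares 1 with 2.
      trace-[]-swap : ∀ m n → R.exitRate (m ∷ []) ≈ α + β → R′.exitRate (n ∷ []) ≈ β + α →
                      ∀ ς ϱ → R.trace (m ∷ []) [] ς ϱ ≈ R′.trace (n ∷ []) [] ς ϱ
      trace-[]-swap m n e e′ ς ϱ = trace-[]-cong (chain α⁺ β⁺) (chain β⁺ α⁺) ς ϱ
        (trans e (trans (+-comm α β) (sym e′)))
        (trans (R.RP≈0 (m ∷ [])) (sym (R′.RP≈0 (n ∷ []))))

      trace-1-swap : ∀ σ ς ϱ → R.trace (1 ∷ []) σ ς ϱ ≈ R′.trace (1 ∷ []) σ ς ϱ
      trace-1-swap []      ς ϱ = trace-[]-swap 1 1 R.exitRate-1 R′.exitRate-1 ς ϱ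
      trace-1-swap (b ∷ σ) ς ϱ = trans (R.trace-1-∷ b σ ς ϱ) (sym (R′.trace-1-∷ b σ ς ϱ))

      -- If no step remains, 2 and 1 are indistinguishable and the two summands trade places.
      -- Otherwise the summand through 1 vanishes on both sides, and the one through 2 carries the
      -- symmetric product of α and β.
      mixture-swap : ∀ σ ς ϱ →
        α * R.ν * R.trace (2 ∷ []) σ ς ϱ + β * R.ν * R.trace (1 ∷ []) σ ς ϱ ≈
        β * R′.ν * R′.trace (2 ∷ []) σ ς ϱ + α * R′.ν * R′.trace (1 ∷ []) σ ς ϱ
      mixture-swap [] ς ϱ = trans (+-comm _ _) (+-cong
        (*-cong (*-congˡ ν-swap) (trace-[]-swap 1 2 R.exitRate-1 R′.exitRate-2 ς ϱ))
        (*-cong (*-congˡ ν-swap) (trace-[]-swap 2 1 R.exitRate-2 R′.exitRate-1 ς ϱ)))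
      mixture-swap (b ∷ σ) ς ϱ = +-cong (through-2 ς ϱ)
        (trans (trans (*-congˡ (R.trace-1-∷ b σ ς ϱ)) (zeroʳ _))
               (sym (trans (*-congˡ (R′.trace-1-∷ b σ ς ϱ)) (zeroʳ _))))
        where
        through-2 : ∀ ς ϱ → α * R.ν * R.trace (2 ∷ []) (b ∷ σ) ς ϱ ≈ β * R′.ν * R′.trace (2 ∷ []) (b ∷ σ) ς ϱ
        through-2 [] ϱ = trans (trans (*-congˡ (R.trace-noSJ (2 ∷ []) b σ ϱ)) (zeroʳ _))
          (sym (trans (*-congˡ (R′.trace-noSJ (2 ∷ []) b σ ϱ)) (zeroʳ _)))
        through-2 (x ∷ ς) [] = trans (trans (*-congˡ (R.trace-noRP (2 ∷ []) b σ (x ∷ ς))) (zeroʳ _))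
          (sym (trans (*-congˡ (R′.trace-noRP (2 ∷ []) b σ (x ∷ ς))) (zeroʳ _)))
        through-2 (x ∷ ς) (r ∷ ϱ) = begin
          α * R.ν * R.trace (2 ∷ []) (b ∷ σ) (x ∷ ς) (r ∷ ϱ)
            ≈⟨ *-congˡ (R.trace-2-∷ b σ x ς r ϱ) ⟩
          α * R.ν * (β * guard (R.Observed (2 ∷ []) x r) (guard (a ≡ b) (R.ν * R.trace (1 ∷ []) σ ς ϱ)))
            ≈⟨ swap α R.ν β _ ⟩
          β * R.ν * (α * guard (R.Observed (2 ∷ []) x r) (guard (a ≡ b) (R.ν * R.trace (1 ∷ []) σ ς ϱ)))
            ≈⟨ *-cong (*-congˡ ν-swap) (*-congˡ (trans
                 (guard-cong (guard-cong (*-cong ν-swap (trace-1-swap σ ς ϱ))))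
                 (Observed-swap 2 R.exitRate-2 R′.exitRate-2 x r))) ⟩
          β * R′.ν * (α * guard (R′.Observed (2 ∷ []) x r) (guard (a ≡ b) (R′.ν * R′.trace (1 ∷ []) σ ς ϱ)))
            ≈⟨ *-congˡ (R′.trace-2-∷ b σ x ς r ϱ) ⟨
          β * R′.ν * R′.trace (2 ∷ []) (b ∷ σ) (x ∷ ς) (r ∷ ϱ) ∎
          where
          swap : ∀ x y z u → x * y * (z * u) ≈ z * y * (x * u)
          swap x y z u = begin
            x * y * (z * u)   ≈⟨ *-assoc _ _ _ ⟨
            x * y * z * u     ≈⟨ *-congʳ (trans (*-assoc x y z) (trans (*-comm x _) (*-congʳ (*-comm y z)))) ⟩
            z * y * x * u     ≈⟨ *-assoc _ _ _ ⟩
            z * y * (x * u)   ∎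

      chain-≡fl : chain α⁺ β⁺ ≡fl chain β⁺ α⁺
      chain-≡fl [] ς ϱ = trace-[]-swap 3 3 R.exitRate-3 R′.exitRate-3 ς ϱ
      chain-≡fl (b ∷ σ) [] ϱ = trans (R.trace-noSJ (3 ∷ []) b σ ϱ) (sym (R′.trace-noSJ (3 ∷ []) b σ ϱ))
      chain-≡fl (b ∷ σ) (x ∷ ς) [] =
        trans (R.trace-noRP (3 ∷ []) b σ (x ∷ ς)) (sym (R′.trace-noRP (3 ∷ []) b σ (x ∷ ς)))
      chain-≡fl (b ∷ σ) (x ∷ ς) (r ∷ ϱ) = begin
        R.trace (3 ∷ []) (b ∷ σ) (x ∷ ς) (r ∷ ϱ)
          ≈⟨ R.trace-3-∷ b σ x ς r ϱ ⟩
        guard (R.Observed (3 ∷ []) x r) (guard (a ≡ b) _)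
          ≈⟨ guard-cong (guard-cong (mixture-swap σ ς ϱ)) ⟩
        guard (R.Observed (3 ∷ []) x r) (guard (a ≡ b) _)
          ≈⟨ Observed-swap 3 R.exitRate-3 R′.exitRate-3 x r ⟩
        guard (R′.Observed (3 ∷ []) x r) (guard (a ≡ b) _)
          ≈⟨ R′.trace-3-∷ b σ x ς r ϱ ⟨
        R′.trace (3 ∷ []) (b ∷ σ) (x ∷ ς) (r ∷ ϱ) ∎

      -- The initial states are compared by their rates into the class of the first net's marking 1.
      -- In the first net this is β, since 2 lies outside the class; in the second it is α or 0,
      -- depending on whether the two markings 1 are related. Neither equals β.
      chain-¬↔fl : ¬ (α ≈ β) → ¬ (chain α⁺ β⁺ ↔fl chain β⁺ α⁺)
      chain-¬↔fl α≉β (_∼_ , isBisimulation) = by-cases em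
        where
        open IsFluidBisimulation isBisimulation renaming (isEquivalence to ∼-isEquivalence)
        module ∼ = IsEquivalence ∼-isEquivalence

        S = State (chain α⁺ β⁺) (chain β⁺ α⁺)

        rm : S → Pred S 0ℓ → Carrier
        rm = stateRM (chain α⁺ β⁺) (chain β⁺ α⁺) a

        -- The index selects the net, `false` the first and `true` the second, so that each
        -- separation lemma covers all pairs.
        s₂ s₁ s₀ : Bool → S
        s₂ false = inj₁ R.D₂
        s₂ true  = inj₂ R′.D₂
        s₁ false = inj₁ R.D₁
        s₁ true  = inj₂ R′.D₁
        s₀ false = inj₁ R.D₀
        s₀ true  = inj₂ R′.D₀

        0<rm-2 : ∀ i H → H (s₁ i) → 0# < rm (s₂ i) H
        0<rm-2 false H h = <-respʳ-≈ (sym (R.RM-2 (H ∘ inj₁)))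
          (+-pos (<-respʳ-≈ (sym (guard-yes h)) (proj₂ β⁺)) (guard-nonNeg (proj₁ (proj₂ α⁺))))
        0<rm-2 true  H h = <-respʳ-≈ (sym (R′.RM-2 (H ∘ inj₂)))
          (+-pos (<-respʳ-≈ (sym (guard-yes h)) (proj₂ α⁺)) (guard-nonNeg (proj₁ (proj₂ β⁺))))

        0<rm-1 : ∀ i H → H (s₀ i) → 0# < rm (s₁ i) H
        0<rm-1 false H h = <-respʳ-≈ (sym (trans (R.RM-1 (H ∘ inj₁)) (guard-yes h)))
          (+-pos (proj₂ α⁺) (proj₁ (proj₂ β⁺)))
        0<rm-1 true  H h = <-respʳ-≈ (sym (trans (R′.RM-1 (H ∘ inj₂)) (guard-yes h)))
          (+-pos (proj₂ β⁺) (proj₁ (proj₂ α⁺)))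

        rm-1≈0 : ∀ i H → ¬ H (s₀ i) → rm (s₁ i) H ≈ 0#
        rm-1≈0 false H ¬h = trans (R.RM-1 (H ∘ inj₁)) (guard-no ¬h)
        rm-1≈0 true  H ¬h = trans (R′.RM-1 (H ∘ inj₂)) (guard-no ¬h)

        rm-0≈0 : ∀ i H → rm (s₀ i) H ≈ 0#
        rm-0≈0 false H = R.RM-0 (H ∘ inj₁)
        rm-0≈0 true  H = R′.RM-0 (H ∘ inj₂)

        -- The rate into the class of `s₀ i` is positive from 1 but 0 from the dead marking.
        1≁0 : ∀ i j → ¬ (s₁ i ∼ s₀ j)
        1≁0 i j r = proj₂ (0<rm-1 i _ ∼.refl)
          (sym (trans (sameRM r (s₀ i) a) (rm-0≈0 j _)))

        -- From 2 the rate into the class of `s₁ j` is positive; from 1 it is 0, as 1 moves only to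
        -- 0, which is outside that class by `1≁0`.
        1≁2 : ∀ i j → ¬ (s₁ i ∼ s₂ j)
        1≁2 i j r = proj₂ (0<rm-2 j _ ∼.refl)
          (sym (trans (sameRM (∼.sym r) (s₁ j) a) (rm-1≈0 i _ (1≁0 j i))))

        rates : β ≈ guard (s₁ false ∼ s₁ true) α
        rates = begin
          β
            ≈⟨ trans (+-cong (guard-no (1≁2 false false)) (guard-yes ∼.refl)) (+-identityˡ β) ⟨
          guard (s₁ false ∼ s₂ false) α + guard (s₁ false ∼ s₁ false) β
            ≈⟨ R.RM-3 _ ⟨
          rm (inj₁ R.D₃) (s₁ false ∼_)
            ≈⟨ sameRM initial (s₁ false) a ⟩
          rm (inj₂ R′.D₃) (s₁ false ∼_)
            ≈⟨ R′.RM-3 _ ⟩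
          guard (s₁ false ∼ s₂ true) β + guard (s₁ false ∼ s₁ true) α
            ≈⟨ trans (+-congʳ (guard-no (1≁2 false true))) (+-identityˡ _) ⟩
          guard (s₁ false ∼ s₁ true) α ∎

        by-cases : Dec (s₁ false ∼ s₁ true) → ⊥
        by-cases (yes r) = α≉β (sym (trans rates (guard-yes r)))
        by-cases (no ¬r) = proj₂ (proj₂ β⁺) (sym (trans rates (guard-no ¬r)))

  -- An action is required: if there were none, nets would have no transitions, and any two would be
  -- bisimilar.
  ≡fl⇏↔fl : Act → ∃₂ λ N N′ → N ≡fl N′ × ¬ (N ↔fl N′)
  ≡fl⇏↔fl a = chain one two , chain two one , chain-≡fl one two , chain-¬↔fl one two 1≉1+1
    where
    open Countdown a

    one two : ℝ>0
    one = 1# , 0<1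
    two = 1# + 1# , +-pos 0<1 (proj₁ 0<1)

    1≉1+1 : ¬ (1# ≈ 1# + 1#)
    1≉1+1 1≈1+1 = 1≉0 (x+x≈x⇒x≈0 1# (sym 1≈1+1))

theorem6p1 : (em : ExcludedMiddle 0ℓ) (ℝ : CompleteOrderedField) (Act : Set) →
    let open LFSPNs em ℝ Act in
    (∀ N N′ → N ↔fl N′ → N ≡fl N′) ×
    (Act → ∃₂ λ N N′ → N ≡fl N′ × ¬ (N ↔fl N′))
theorem6p1 em ℝ Act = ↔fl⇒≡fl , ≡fl⇏↔fl
  where open FluidEquivalences em ℝ Act
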